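{- Let $r>0$ be a fixed integer. There exist a constant $c>0$ and infinitely many $n$ such that, for each such $n$, there is a hypergraph $H$ on $n$ vertices which is both $r$-cross-free and $r$-closed, and such that every sub-hypergraph $H'\subseteq H$ with $\mathrm{cl}_r(H')=H$ has at least $c\, n^r$ hyperedges (i.e. $\Omega(n^r)$ hyperedges).
   Context: Hypergraphs have vertex set $V=[n]$ and are identified with their sets of hyperedges; a sub-hypergraph is a subset of the hyperedge set; $\overline A = V\setminus A$. $\mathcal K_r(n)$ is the class of hypergraphs $\mathcal E$ on $V$ satisfying: (R0) every $X\subseteq V$ with $|X|\le r$ is in $\mathcal E$; (R1) $A\in\mathcal E\Rightarrow V\setminus A\in\mathcal E$; (R2) $A,B\in\mathcal E$ and $|A\cap B|\ge r\Rightarrow A\cup B\in\mathcal E$. $\mathcal K^0_r(n)$ is the class satisfying (R0) and (R1) only. $\mathrm{cl}_r(H)$ (resp. $\mathrm{cl}^0_r(H)$) is the intersection of all hypergraphs in $\mathcal K_r(n)$ (resp. $\mathcal K^0_r(n)$) containing $H$. $H$ is $r$-closed if $\mathrm{cl}_r(H)=H$. Sets $A,B\subseteq V$ are $r$-orthogonal if $\mathrm{cl}_r(\{A,B\})=\mathrm{cl}^0_r(\{A,B\})$. A hypergraph is $r$-cross-free if every pair of its hyperedges is $r$-orthogonal. -}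

module Defs where

open import Data.Bool using (Bool; T; _∨_)
import Data.Bool.Properties as Bool
open import Data.Fin.Subset using (Subset; inside; outside; ∁; _∩_; _∪_; ∣_∣)
open import Data.List using (List; []; _∷_; _++_; map; length; filterᵇ)
open import Data.Nat using (ℕ; zero; suc; _≤_)
import Data.Vec as Vec
open import Data.Vec.Properties using (≡-dec)
open import Level using (0ℓ)
open import Relation.Binary using (DecidableEquality)
open import Relation.Nullary.Decidable using (⌊_⌋)
open import Relation.Unary using (Pred; _≐_)

private
  variable
    n : ℕ

-- A hypergraph on the vertex set Fin n is given by the characteristic
-- function of its (finite) set of hyperedges.
Hypergraph : ℕ → Set
Hypergraph n = Subset n → Bool

infix 4 _∈ᴴ_ _⊆ᴴ_

_∈ᴴ_ : Subset n → Hypergraph n → Set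
A ∈ᴴ H = T (H A)

_⊆ᴴ_ : Hypergraph n → Hypergraph n → Set
H ⊆ᴴ G = ∀ A → A ∈ᴴ H → A ∈ᴴ G

_≟ˢ_ : DecidableEquality (Subset n)
_≟ˢ_ = ≡-dec Bool._≟_

pair : Subset n → Subset n → Hypergraph n
pair A B X = ⌊ X ≟ˢ A ⌋ ∨ ⌊ X ≟ˢ B ⌋

allSubsets : (n : ℕ) → List (Subset n)
allSubsets zero    = Vec.[] ∷ []
allSubsets (suc n) = map (outside Vec.∷_) (allSubsets n) ++ map (inside Vec.∷_) (allSubsets n)

numHyperedges : Hypergraph n → ℕ
numHyperedges {n} H = length (filterᵇ H (allSubsets n))

record K⁰ (r : ℕ) (E : Hypergraph n) : Set where
  field
    R0 : ∀ X → ∣ X ∣ ≤ r → X ∈ᴴ E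
    R1 : ∀ A → A ∈ᴴ E → ∁ A ∈ᴴ E

record K (r : ℕ) (E : Hypergraph n) : Set where
  field
    R0 : ∀ X → ∣ X ∣ ≤ r → X ∈ᴴ E
    R1 : ∀ A → A ∈ᴴ E → ∁ A ∈ᴴ E
    R2 : ∀ A B → A ∈ᴴ E → B ∈ᴴ E → r ≤ ∣ A ∩ B ∣ → A ∪ B ∈ᴴ E

-- The intersection of all members of a class that contain H.  It is a
-- predicate on subsets, compared with other predicates extensionally by _≐_.
⋂⟨_⟩ : (Hypergraph n → Set) → Hypergraph n → Pred (Subset n) 0ℓ
⋂⟨ C ⟩ H X = ∀ E → C E → H ⊆ᴴ E → X ∈ᴴ E

cl : ℕ → Hypergraph n → Pred (Subset n) 0ℓ
cl r = ⋂⟨ K r ⟩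

cl⁰ : ℕ → Hypergraph n → Pred (Subset n) 0ℓ
cl⁰ r = ⋂⟨ K⁰ r ⟩

Closed : ℕ → Hypergraph n → Set
Closed r H = cl r H ≐ (_∈ᴴ H)

Orthogonal : ℕ → Subset n → Subset n → Set
Orthogonal r A B = cl r (pair A B) ≐ cl⁰ r (pair A B)

CrossFree : ℕ → Hypergraph n → Set
CrossFree r H = ∀ A B → A ∈ᴴ H → B ∈ᴴ H → Orthogonal r A B

{-# OPTIONS --safe #-}
module Submission where

-- Call a family F of (r+1)-sets sparse if distinct members meet in fewer than r points.
-- The sets of size at most r together with F form a family that is closed under subsets
-- and under unions A ∪ B with |A ∩ B| ≥ r, since then A ⊆ B or B ⊆ A.  Adding the
-- complements gives a member of K r: a union involving a complement is the complement
-- of a subset.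
-- The same holds for every subfamily of F, so two hyperedges generate nothing beyond
-- the trivial sets, themselves and their complements, and a generating sub-hypergraph
-- must contain each member of F or its complement.  A sparse family of order n^r
-- consists of the transversals of r + 1 disjoint blocks whose last coordinate is the
-- sum of the others, so that any r coordinates determine the remaining one.

open import Defs
open import Data.Nat using (ℕ; _^_) renaming (_<_ to _<ᴺ_; _≤_ to _≤ᴺ_)
open import Data.Integer using (+_)
open import Data.Rational using (ℚ; 0ℚ; _/_; _*_; _≤_; _<_)
open import Data.Product using (∃-syntax; _×_)
open import Relation.Unary using (_≐_)

open import Data.Bool using (_∧_; _∨_)
open import Data.Bool.Properties using (T?; T-∧; T-∨)
open import Data.Fin using (Fin; toℕ; fromℕ<; combine; remQuot)
import Data.Fin as Fin
import Data.Fin.Properties as Fin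
open import Data.Fin.Subset using (Subset; Empty; inside; outside; ∁; _∩_; _∪_; ∣_∣; _⊆_; ⁅_⁆)
open import Data.Fin.Subset.Properties
open import Algebra.Lattice.Properties.BooleanAlgebra using (¬-involutive; deMorgan₂)
import Data.Integer as ℤ
import Data.Integer.Properties as ℤ
import Data.List as List
open import Data.List.Membership.Propositional using (_∈_)
open import Data.List.Membership.Propositional.Properties using (∈-map⁺; ∈-++⁺ˡ; ∈-++⁺ʳ; ∈-filter⁺)
import Data.List.Membership.Setoid.Properties as Membership
open import Data.List.Relation.Unary.Any using (here; index)
open import Data.Nat using (zero; suc; _+_; _≤?_; NonZero; s≤s; z≤n; s≤s⁻¹) renaming (_*_ to _*ᴺ_)
import Data.Nat.Properties as ℕ
open import Data.Product using (_,_; proj₁; proj₂; uncurry)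
import Data.Rational as ℚ
import Data.Rational.Properties as ℚ
import Data.Rational.Unnormalised as ℚᵘ
import Data.Rational.Unnormalised.Properties as ℚᵘ
open import Data.Sum using (_⊎_; inj₁; inj₂; [_,_]′)
import Data.Sum as Sum
open import Data.Vec as Vec using (Vec; []; _∷_; _++_)
open import Data.Vec.Properties using (zipWith-++; ∷-injective)
open import Function using (_∘_; Equivalence)
open import Function.Definitions using (Injective)
open import Relation.Binary.PropositionalEquality
open import Relation.Nullary using (Dec; yes; no; contradiction)
open import Relation.Nullary.Decidable using (⌊_⌋; _⊎-dec_; toWitness; fromWitness)

private
  variable
    n m k r : ℕ

-- Cardinalities of subsets, unions and complements.

∁-involutive : (p : Subset n) → ∁ (∁ p) ≡ p
∁-involutive = ¬-involutive (∪-∩-booleanAlgebra _)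

∁-∪ : (p q : Subset n) → ∁ (p ∪ q) ≡ ∁ p ∩ ∁ q
∁-∪ = deMorgan₂ (∪-∩-booleanAlgebra _)

⊆⇒≡⊎∣∣< : {p q : Subset n} → p ⊆ q → p ≡ q ⊎ ∣ p ∣ <ᴺ ∣ q ∣
⊆⇒≡⊎∣∣< {p = []}          {[]}          p⊆q = inj₁ refl
⊆⇒≡⊎∣∣< {p = outside ∷ p} {outside ∷ q} p⊆q =
  Sum.map₁ (cong (outside ∷_)) (⊆⇒≡⊎∣∣< (drop-∷-⊆ p⊆q))
⊆⇒≡⊎∣∣< {p = outside ∷ p} {inside ∷ q}  p⊆q = inj₂ (s≤s (p⊆q⇒∣p∣≤∣q∣ (drop-∷-⊆ p⊆q)))
⊆⇒≡⊎∣∣< {p = inside ∷ p}  {outside ∷ q} p⊆q = contradiction (p⊆q Vec.here) λ ()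
⊆⇒≡⊎∣∣< {p = inside ∷ p}  {inside ∷ q}  p⊆q =
  Sum.map (cong (inside ∷_)) s≤s (⊆⇒≡⊎∣∣< (drop-∷-⊆ p⊆q))

∣p∣≤∣p∩q∣⇒p∪q≡q : (p q : Subset n) → ∣ p ∣ ≤ᴺ ∣ p ∩ q ∣ → p ∪ q ≡ q
∣p∣≤∣p∩q∣⇒p∪q≡q p q le with ⊆⇒≡⊎∣∣< (p∩q⊆p p q)
... | inj₂ lt = contradiction le (ℕ.<⇒≱ lt)
... | inj₁ eq = begin
  p ∪ q        ≡⟨ ∪-comm p q ⟩
  q ∪ p        ≡⟨ cong (q ∪_) (trans (sym eq) (∩-comm p q)) ⟩
  q ∪ (q ∩ p)  ≡⟨ ∪-abs-∩ q p ⟩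
  q            ∎
  where open ≡-Reasoning

∣p∣+∣∁p∣≡n : (p : Subset n) → ∣ p ∣ + ∣ ∁ p ∣ ≡ n
∣p∣+∣∁p∣≡n p = trans (cong (λ x → ∣ p ∣ + x) (∣∁p∣≡n∸∣p∣ p)) (ℕ.m+[n∸m]≡n (∣p∣≤n p))

∣++∣ : (p : Subset m) (q : Subset n) → ∣ p ++ q ∣ ≡ ∣ p ∣ + ∣ q ∣
∣++∣ []            q = refl
∣++∣ (outside ∷ p) q = ∣++∣ p q
∣++∣ (inside ∷ p)  q = cong suc (∣++∣ p q)

∣++∩++∣ : (p p′ : Subset m) (q q′ : Subset n) →
          ∣ (p ++ q) ∩ (p′ ++ q′) ∣ ≡ ∣ p ∩ p′ ∣ + ∣ q ∩ q′ ∣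
∣++∩++∣ p p′ q q′ = trans (cong ∣_∣ (zipWith-++ _ p q p′ q′)) (∣++∣ (p ∩ p′) (q ∩ q′))

∣⁅x⁆∩⁅x⁆∣≡1 : (x : Fin n) → ∣ ⁅ x ⁆ ∩ ⁅ x ⁆ ∣ ≡ 1
∣⁅x⁆∩⁅x⁆∣≡1 x = trans (cong ∣_∣ (∩-idem ⁅ x ⁆)) (∣⁅x⁆∣≡1 x)

∣⁅x⁆∩⁅y⁆∣≡0 : {x y : Fin n} → x ≢ y → ∣ ⁅ x ⁆ ∩ ⁅ y ⁆ ∣ ≡ 0
∣⁅x⁆∩⁅y⁆∣≡0 {n} {x} {y} x≢y = trans (cong ∣_∣ (Empty-unique empty)) (∣⊥∣≡0 n)
  where
  empty : Empty (⁅ x ⁆ ∩ ⁅ y ⁆)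
  empty (z , z∈) with z∈x , z∈y ← x∈p∩q⁻ ⁅ x ⁆ ⁅ y ⁆ z∈ =
    x≢y (trans (sym (x∈⁅y⁆⇒x≡y x z∈x)) (x∈⁅y⁆⇒x≡y y z∈y))

-- Sparse families (partial Steiner systems: an `r`-set lies in at most one member) and their hulls.

record Sparse (r : ℕ) (F : Hypergraph n) : Set where
  field
    size : ∀ {A} → A ∈ᴴ F → ∣ A ∣ ≡ suc r
    sep  : ∀ {A B} → A ∈ᴴ F → B ∈ᴴ F → r ≤ᴺ ∣ A ∩ B ∣ → A ≡ B

Sparse-⊆ : {F G : Hypergraph n} → G ⊆ᴴ F → Sparse r F → Sparse r G
Sparse-⊆ G⊆F F-sparse = record
  { size = λ A∈G → size (G⊆F _ A∈G)
  ; sep  = λ A∈G B∈G → sep (G⊆F _ A∈G) (G⊆F _ B∈G)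
  }
  where open Sparse F-sparse

Core : ℕ → Hypergraph n → Subset n → Set
Core r F X = ∣ X ∣ ≤ᴺ r ⊎ X ∈ᴴ F

core? : (r : ℕ) (F : Hypergraph n) (X : Subset n) → Dec (Core r F X)
core? r F X = (∣ X ∣ ≤? r) ⊎-dec T? (F X)

-- The least member of `K⁰ r` containing `F`, given as a decision because hypergraphs are
-- Boolean-valued.
hull : ℕ → Hypergraph n → Hypergraph n
hull r F X = ⌊ core? r F X ⊎-dec core? r F (∁ X) ⌋

hull⁺ : (F : Hypergraph n) (X : Subset n) → Core r F X ⊎ Core r F (∁ X) → X ∈ᴴ hull r F
hull⁺ {r = r} F X = fromWitness {a? = core? r F X ⊎-dec core? r F (∁ X)}

hull⁻ : (F : Hypergraph n) (X : Subset n) → X ∈ᴴ hull r F → Core r F X ⊎ Core r F (∁ X)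
hull⁻ {r = r} F X = toWitness {a? = core? r F X ⊎-dec core? r F (∁ X)}

F⊆hull : (F : Hypergraph n) → F ⊆ᴴ hull r F
F⊆hull F X X∈F = hull⁺ F X (inj₁ (inj₂ X∈F))

∁-hull : (F : Hypergraph n) (X : Subset n) → X ∈ᴴ hull r F → ∁ X ∈ᴴ hull r F
∁-hull {r = r} F X X∈ =
  hull⁺ F (∁ X) (Sum.swap (Sum.map₁ (subst (Core r F) (sym (∁-involutive X))) (hull⁻ F X X∈)))

module _ {F : Hypergraph n} (F-sparse : Sparse r F) where

  open Sparse F-sparse

  -- A proper subset of an `(r+1)`-set has at most `r` points.
  core-⊆ : ∀ {A B} → A ⊆ B → Core r F B → Core r F A
  core-⊆ A⊆B (inj₁ B≤r) = inj₁ (ℕ.≤-trans (p⊆q⇒∣p∣≤∣q∣ A⊆B) B≤r)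
  core-⊆ A⊆B (inj₂ B∈F) with ⊆⇒≡⊎∣∣< A⊆B
  ... | inj₁ refl = inj₂ B∈F
  ... | inj₂ A<B  = inj₁ (s≤s⁻¹ (subst (_ <ᴺ_) (size B∈F) A<B))

  -- A set of size at most `r` that meets another in at least `r` points is contained in it, and two
  -- members of `F` with such an overlap coincide by `sep`. In every case the union is one of the
  -- two sets.
  core-∪ : ∀ A B → Core r F A → Core r F B → r ≤ᴺ ∣ A ∩ B ∣ → Core r F (A ∪ B)
  core-∪ A B (inj₁ A≤r) cB r≤ =
    subst (Core r F) (sym (∣p∣≤∣p∩q∣⇒p∪q≡q A B (ℕ.≤-trans A≤r r≤))) cB
  core-∪ A B cA@(inj₂ _) (inj₁ B≤r) r≤ =
    subst (Core r F)
      (sym (trans (∪-comm A B)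
        (∣p∣≤∣p∩q∣⇒p∪q≡q B A (ℕ.≤-trans B≤r (subst (λ X → r ≤ᴺ ∣ X ∣) (∩-comm A B) r≤))))) cA
  core-∪ A B (inj₂ A∈F) (inj₂ B∈F) r≤ with refl ← sep A∈F B∈F r≤ =
    subst (Core r F) (sym (∪-idem A)) (inj₂ A∈F)

  hull-K : K r (hull r F)
  hull-K = record
    { R0 = λ X X≤r → hull⁺ F X (inj₁ (inj₁ X≤r))
    ; R1 = ∁-hull F
    ; R2 = λ A B A∈ B∈ r≤ → hull⁺ F (A ∪ B) (union A B (hull⁻ F A A∈) (hull⁻ F B B∈) r≤)
    }
    where
    union : ∀ A B → Core r F A ⊎ Core r F (∁ A) → Core r F B ⊎ Core r F (∁ B) →
            r ≤ᴺ ∣ A ∩ B ∣ → Core r F (A ∪ B) ⊎ Core r F (∁ (A ∪ B))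
    union A B (inj₁ cA) (inj₁ cB) r≤ = inj₁ (core-∪ A B cA cB r≤)
    union A B (inj₂ cA) _ _ =
      inj₂ (subst (Core r F) (sym (∁-∪ A B)) (core-⊆ (p∩q⊆p (∁ A) (∁ B)) cA))
    union A B (inj₁ _) (inj₂ cB) _ =
      inj₂ (subst (Core r F) (sym (∁-∪ A B)) (core-⊆ (p∩q⊆q (∁ A) (∁ B)) cB))

-- Restriction to subfamilies; the hull is closed and cross-free.

infixr 7 _∩ᴴ_

_∩ᴴ_ : Hypergraph n → Hypergraph n → Hypergraph n
(F ∩ᴴ G) X = F X ∧ G X

∩ᴴ-⊆ˡ : (F G : Hypergraph n) → F ∩ᴴ G ⊆ᴴ F
∩ᴴ-⊆ˡ F G X = proj₁ ∘ Equivalence.to T-∧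

∩ᴴ-⊆ʳ : (F G : Hypergraph n) → F ∩ᴴ G ⊆ᴴ G
∩ᴴ-⊆ʳ F G X = proj₂ ∘ Equivalence.to (T-∧ {F X})

-- Moves hyperedges into the hull of a subfamily of `F`. Closure of `G` under complements covers the
-- case where `∁ X`, rather than `X`, is the core set.
hull-∩ᴴ : (F G : Hypergraph n) → (∀ A → A ∈ᴴ G → ∁ A ∈ᴴ G) →
          ∀ X → X ∈ᴴ hull r F → X ∈ᴴ G → X ∈ᴴ hull r (F ∩ᴴ G)
hull-∩ᴴ {r = r} F G ∁-G X X∈hull X∈G =
  hull⁺ (F ∩ᴴ G) X (Sum.map (restrict X∈G) (restrict (∁-G X X∈G)) (hull⁻ F X X∈hull))
  where
  restrict : ∀ {Y} → Y ∈ᴴ G → Core r F Y → Core r (F ∩ᴴ G) Y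
  restrict Y∈G = Sum.map₂ λ Y∈F → Equivalence.from T-∧ (Y∈F , Y∈G)

K⇒K⁰ : {E : Hypergraph n} → K r E → K⁰ r E
K⇒K⁰ E∈K = record { R0 = R0 ; R1 = R1 }
  where open K E∈K

hull-⊆ : {E : Hypergraph n} → K⁰ r E → (F : Hypergraph n) → F ⊆ᴴ E → hull r F ⊆ᴴ E
hull-⊆ {r = r} {E} E∈K⁰ F F⊆E X X∈ =
  [ core-⊆E X , subst (_∈ᴴ E) (∁-involutive X) ∘ R1 (∁ X) ∘ core-⊆E (∁ X) ]′ (hull⁻ F X X∈)
  where
  open K⁰ E∈K⁰
  core-⊆E : ∀ Y → Core r F Y → Y ∈ᴴ E
  core-⊆E Y = [ R0 Y , F⊆E Y ]′

hull-closed : {F : Hypergraph n} → Sparse r F → Closed r (hull r F)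
hull-closed F-sparse = (λ X∈cl → X∈cl _ (hull-K F-sparse) λ _ X∈ → X∈) , λ X∈ E _ H⊆E → H⊆E _ X∈

pair⁺ˡ : (A B : Subset n) → A ∈ᴴ pair A B
pair⁺ˡ A B = Equivalence.from T-∨ (inj₁ (fromWitness {a? = A ≟ˢ A} refl))

pair⁺ʳ : (A B : Subset n) → B ∈ᴴ pair A B
pair⁺ʳ A B = Equivalence.from (T-∨ {⌊ B ≟ˢ A ⌋}) (inj₂ (fromWitness {a? = B ≟ˢ B} refl))

pair-⊆ : (A B : Subset n) {G : Hypergraph n} → A ∈ᴴ G → B ∈ᴴ G → pair A B ⊆ᴴ G
pair-⊆ A B {G} A∈G B∈G X X∈ =
  [ (λ e → subst (_∈ᴴ G) (sym (toWitness {a? = X ≟ˢ A} e)) A∈G)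
  , (λ e → subst (_∈ᴴ G) (sym (toWitness {a? = X ≟ˢ B} e)) B∈G)
  ]′ (Equivalence.to (T-∨ {⌊ X ≟ˢ A ⌋}) X∈)

-- For `E` in `K⁰ r` containing `A` and `B`, the hull of `F ∩ᴴ E` is in `K r`, since a subfamily of
-- a sparse family is sparse. It contains `A` and `B` and lies inside `E`, so everything in the
-- `cl r` of the pair is in `E`.
hull-crossFree : {F : Hypergraph n} → Sparse r F → CrossFree r (hull r F)
hull-crossFree {r = r} {F} F-sparse A B A∈ B∈ = cl⊆cl⁰ , λ X∈cl⁰ E E∈K → X∈cl⁰ E (K⇒K⁰ E∈K)
  where
  cl⊆cl⁰ : ∀ {X} → cl r (pair A B) X → cl⁰ r (pair A B) X
  cl⊆cl⁰ X∈cl E E∈K⁰ AB⊆E =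
    hull-⊆ E∈K⁰ (F ∩ᴴ E) (∩ᴴ-⊆ʳ F E) _
      (X∈cl (hull r (F ∩ᴴ E)) (hull-K (Sparse-⊆ (∩ᴴ-⊆ˡ F E) F-sparse))
        (pair-⊆ A B (restrict A∈ (AB⊆E A (pair⁺ˡ A B))) (restrict B∈ (AB⊆E B (pair⁺ʳ A B)))))
    where
    restrict : ∀ {Y} → Y ∈ᴴ hull r F → Y ∈ᴴ E → Y ∈ᴴ hull r (F ∩ᴴ E)
    restrict = hull-∩ᴴ F E (K⁰.R1 E∈K⁰) _

-- Members of a sparse family are indispensable up to complement.

symmetrize : Hypergraph n → Hypergraph n
symmetrize H X = H X ∨ H (∁ X)

symmetrize-∁ : (H : Hypergraph n) → ∀ X → X ∈ᴴ symmetrize H → ∁ X ∈ᴴ symmetrize H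
symmetrize-∁ H X X∈ = Equivalence.from (T-∨ {H (∁ X)})
  (Sum.swap (Sum.map₁ (subst (_∈ᴴ H) (sym (∁-involutive X))) (Equivalence.to (T-∨ {H X}) X∈)))

-- With `G = symmetrize H`, the hull of `F ∩ᴴ G` is a member of `K r` containing `H`, hence contains
-- `A`. Both `A` and `∁ A` have more than `r` points, so `A` or `∁ A` belongs to `F ∩ᴴ G`.
generating : {F : Hypergraph n} → suc (r + r) <ᴺ n → Sparse r F →
             (H : Hypergraph n) → H ⊆ᴴ hull r F → (∀ {X} → X ∈ᴴ hull r F → cl r H X) →
             ∀ A → A ∈ᴴ F → A ∈ᴴ H ⊎ ∁ A ∈ᴴ H
generating {n = n} {r} {F} n-large F-sparse H H⊆ H-gen A A∈F =
  Equivalence.to (T-∨ {H A}) A∈G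
  where
  open Sparse F-sparse
  G = symmetrize H

  A∈hull : A ∈ᴴ hull r (F ∩ᴴ G)
  A∈hull = H-gen (F⊆hull F A A∈F) _ (hull-K (Sparse-⊆ (∩ᴴ-⊆ˡ F G) F-sparse))
    λ X X∈H → hull-∩ᴴ F G (symmetrize-∁ H) X (H⊆ X X∈H) (Equivalence.from T-∨ (inj₁ X∈H))

  A∈G : A ∈ᴴ G
  A∈G with hull⁻ (F ∩ᴴ G) A A∈hull
  ... | inj₁ (inj₁ A≤r)  = contradiction (ℕ.≤-reflexive (sym (size A∈F))) (ℕ.≤⇒≯ A≤r)
  ... | inj₁ (inj₂ A∈)   = ∩ᴴ-⊆ʳ F G A A∈
  ... | inj₂ (inj₁ ∁A≤r) = contradiction n-large (ℕ.≤⇒≯ (begin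
    n                ≡⟨ ∣p∣+∣∁p∣≡n A ⟨
    ∣ A ∣ + ∣ ∁ A ∣  ≤⟨ ℕ.+-mono-≤ (ℕ.≤-reflexive (size A∈F)) ∁A≤r ⟩
    suc r + r        ∎))
    where open ℕ.≤-Reasoning
  -- This can occur when `n` is `2r + 2`, where `∁ A` may itself be a member of `F`; the symmetry of
  -- `G` settles it.
  ... | inj₂ (inj₂ ∁A∈)  =
    subst (_∈ᴴ G) (∁-involutive A) (symmetrize-∁ H (∁ A) (∩ᴴ-⊆ʳ F G (∁ A) ∁A∈))

-- Counting the hyperedges of a generating sub-hypergraph.

∈-allSubsets : (X : Subset n) → X ∈ allSubsets n
∈-allSubsets []            = here refl
∈-allSubsets (outside ∷ X) = ∈-++⁺ˡ (∈-map⁺ (outside ∷_) (∈-allSubsets X))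
∈-allSubsets (inside ∷ X)  = ∈-++⁺ʳ _ (∈-map⁺ (inside ∷_) (∈-allSubsets X))

-- Distinct hyperedges occupy distinct positions in the filtered list, so mapping `i` to the
-- position of `f i` is injective.
injection⇒≤numHyperedges : (H : Hypergraph n) (f : Fin k → Subset n) → Injective _≡_ _≡_ f →
                           (∀ i → f i ∈ᴴ H) → k ≤ᴺ numHyperedges H
injection⇒≤numHyperedges {n} H f f-inj f∈H =
  Fin.injective⇒≤ {f = index ∘ listed} λ eq →
    f-inj (Membership.index-injective (setoid _) (listed _) (listed _) eq)
  where
  listed : ∀ i → f i ∈ List.filterᵇ H (allSubsets n)
  listed i = ∈-filter⁺ (T? ∘ H) (∈-allSubsets (f i)) (f∈H i)

image : (Fin k → Subset n) → Hypergraph n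
image f X = ⌊ Fin.any? (λ i → X ≟ˢ f i) ⌋

image⁺ : (f : Fin k → Subset n) → ∀ i → f i ∈ᴴ image f
image⁺ f i = fromWitness {a? = Fin.any? (λ j → f i ≟ˢ f j)} (i , refl)

image⁻ : (f : Fin k → Subset n) → ∀ X → X ∈ᴴ image f → ∃[ i ] X ≡ f i
image⁻ f X = toWitness {a? = Fin.any? (λ j → X ≟ˢ f j)}

module _ {r : ℕ} (f : Fin k → Subset n) (f-size : ∀ i → ∣ f i ∣ ≡ suc r)
         (f-sep : ∀ i j → r ≤ᴺ ∣ f i ∩ f j ∣ → i ≡ j) where

  image-sparse : Sparse r (image f)
  image-sparse = record { size = size ; sep = sep }
    where
    size : ∀ {A} → A ∈ᴴ image f → ∣ A ∣ ≡ suc r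
    size {A} A∈ with i , refl ← image⁻ f A A∈ = f-size i
    sep : ∀ {A B} → A ∈ᴴ image f → B ∈ᴴ image f → r ≤ᴺ ∣ A ∩ B ∣ → A ≡ B
    sep {A} {B} A∈ B∈ r≤ with i , refl ← image⁻ f A A∈ | j , refl ← image⁻ f B B∈ =
      cong f (f-sep i j r≤)

  -- For each `i`, `H` contains `f i` or its complement. These choices are distinct: since `n`
  -- exceeds `2r + 2`, no `(r+1)`-set is the complement of another.
  generating-size : suc r + suc r <ᴺ n → (H : Hypergraph n) → H ⊆ᴴ hull r (image f) →
                    (∀ {X} → X ∈ᴴ hull r (image f) → cl r H X) → k ≤ᴺ numHyperedges H
  generating-size n-large H H⊆ H-gen =
    injection⇒≤numHyperedges H (proj₁ ∘ rep) (λ {i} {j} → rep-inj i j) (proj₁ ∘ proj₂ ∘ rep)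
    where
    n-large′ : suc (r + r) <ᴺ n
    n-large′ = ℕ.≤-<-trans (s≤s (ℕ.+-monoʳ-≤ r (ℕ.n≤1+n r))) n-large

    rep : ∀ i → ∃[ X ] X ∈ᴴ H × (X ≡ f i ⊎ X ≡ ∁ (f i))
    rep i = [ (λ ∈H → f i , ∈H , inj₁ refl) , (λ ∈H → ∁ (f i) , ∈H , inj₂ refl) ]′
      (generating n-large′ image-sparse H H⊆ H-gen (f i) (image⁺ f i))

    f-inj : ∀ i j → f i ≡ f j → i ≡ j
    f-inj i j eq = f-sep i j (begin
      r                ≤⟨ ℕ.n≤1+n r ⟩
      suc r            ≡⟨ f-size i ⟨
      ∣ f i ∣          ≡⟨ cong ∣_∣ (∩-idem (f i)) ⟨
      ∣ f i ∩ f i ∣    ≡⟨ cong (λ X → ∣ f i ∩ X ∣) eq ⟩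
      ∣ f i ∩ f j ∣    ∎)
      where open ℕ.≤-Reasoning

    f≢∁f : ∀ i j → f i ≢ ∁ (f j)
    f≢∁f i j eq = ℕ.<-irrefl (begin-equality
      suc r + suc r          ≡⟨ cong₂ _+_ (f-size j) (f-size i) ⟨
      ∣ f j ∣ + ∣ f i ∣      ≡⟨ cong (λ X → ∣ f j ∣ + ∣ X ∣) eq ⟩
      ∣ f j ∣ + ∣ ∁ (f j) ∣  ≡⟨ ∣p∣+∣∁p∣≡n (f j) ⟩
      n                      ∎) n-large
      where open ℕ.≤-Reasoning

    rep-inj : ∀ i j → proj₁ (rep i) ≡ proj₁ (rep j) → i ≡ j
    rep-inj i j eq with proj₂ (proj₂ (rep i)) | proj₂ (proj₂ (rep j))
    ... | inj₁ p | inj₁ q = f-inj i j (trans (sym p) (trans eq q))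
    ... | inj₁ p | inj₂ q = contradiction (trans (sym p) (trans eq q)) (f≢∁f i j)
    ... | inj₂ p | inj₁ q = contradiction (trans (sym q) (trans (sym eq) p)) (f≢∁f j i)
    ... | inj₂ p | inj₂ q = f-inj i j (begin
      f i          ≡⟨ ∁-involutive (f i) ⟨
      ∁ (∁ (f i))  ≡⟨ cong ∁ (trans (sym p) (trans eq q)) ⟩
      ∁ (∁ (f j))  ≡⟨ ∁-involutive (f j) ⟩
      f j          ∎)
      where open ≡-Reasoning

-- Transversals of blocks and a sum-check construction of a sparse family.

total : Vec (Fin m) k → ℕ
total []       = 0
total (x ∷ xs) = toℕ x + total xs

total≤ : (xs : Vec (Fin m) k) → total xs ≤ᴺ k *ᴺ m
total≤ []       = z≤n
total≤ (x ∷ xs) = ℕ.+-mono-≤ (ℕ.<⇒≤ (Fin.toℕ<n x)) (total≤ xs)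

total< : (xs : Vec (Fin m) (suc k)) → total xs <ᴺ suc k *ᴺ m
total< (x ∷ xs) = ℕ.+-mono-<-≤ (Fin.toℕ<n x) (total≤ xs)

transversal : Vec (Fin m) k → Subset (k *ᴺ m)
transversal []       = []
transversal (x ∷ xs) = ⁅ x ⁆ ++ transversal xs

∣transversal∣ : (xs : Vec (Fin m) k) → ∣ transversal xs ∣ ≡ k
∣transversal∣ []       = refl
∣transversal∣ (x ∷ xs) =
  trans (∣++∣ ⁅ x ⁆ (transversal xs)) (cong₂ _+_ (∣⁅x⁆∣≡1 x) (∣transversal∣ xs))

-- The number of coordinates in which the vectors agree, that is, `k` minus their Hamming distance.
agreement : Vec (Fin m) k → Vec (Fin m) k → ℕ
agreement xs ys = ∣ transversal xs ∩ transversal ys ∣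

agreement≤ : (xs ys : Vec (Fin m) k) → agreement xs ys ≤ᴺ k
agreement≤ xs ys =
  subst (agreement xs ys ≤ᴺ_) (∣transversal∣ xs) (∣p∩q∣≤∣p∣ (transversal xs) (transversal ys))

agreement-≡ : (x : Fin m) (xs ys : Vec (Fin m) k) → agreement (x ∷ xs) (x ∷ ys) ≡ suc (agreement xs ys)
agreement-≡ x xs ys = trans (∣++∩++∣ ⁅ x ⁆ ⁅ x ⁆ (transversal xs) (transversal ys))
  (cong (_+ agreement xs ys) (∣⁅x⁆∩⁅x⁆∣≡1 x))

agreement-≢ : {x y : Fin m} (xs ys : Vec (Fin m) k) → x ≢ y →
            agreement (x ∷ xs) (y ∷ ys) ≡ agreement xs ys
agreement-≢ {x = x} {y} xs ys x≢y = trans (∣++∩++∣ ⁅ x ⁆ ⁅ y ⁆ (transversal xs) (transversal ys))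
  (cong (_+ agreement xs ys) (∣⁅x⁆∩⁅y⁆∣≡0 x≢y))

k≤agreement⇒≡ : (xs ys : Vec (Fin m) k) → k ≤ᴺ agreement xs ys → xs ≡ ys
k≤agreement⇒≡ []       []       _  = refl
k≤agreement⇒≡ (x ∷ xs) (y ∷ ys) k≤ with x Fin.≟ y
... | yes refl = cong (x ∷_) (k≤agreement⇒≡ xs ys (s≤s⁻¹ (subst (_ ≤ᴺ_) (agreement-≡ x xs ys) k≤)))
... | no  x≢y  = contradiction (subst (_ ≤ᴺ_) (agreement-≢ xs ys x≢y) k≤) (ℕ.≤⇒≯ (agreement≤ xs ys))

-- At most one coordinate can differ, and cancelling the others from the equal totals shows that it
-- agrees too.
k≤1+agreement⇒≡ : (xs ys : Vec (Fin m) k) → total xs ≡ total ys →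
                k ≤ᴺ suc (agreement xs ys) → xs ≡ ys
k≤1+agreement⇒≡ []       []       _  _  = refl
k≤1+agreement⇒≡ (x ∷ xs) (y ∷ ys) eq k≤ with x Fin.≟ y
... | yes refl = cong (x ∷_) (k≤1+agreement⇒≡ xs ys (ℕ.+-cancelˡ-≡ (toℕ x) _ _ eq)
                   (s≤s⁻¹ (subst (λ o → _ ≤ᴺ suc o) (agreement-≡ x xs ys) k≤)))
... | no  x≢y with refl ← k≤agreement⇒≡ xs ys (s≤s⁻¹ (subst (λ o → _ ≤ᴺ suc o) (agreement-≢ xs ys x≢y) k≤)) =
  contradiction (Fin.toℕ-injective (ℕ.+-cancelʳ-≡ (total xs) _ _ eq)) x≢y

-- The exact sum, not a residue modulo `m`: the last block has `suc k *ᴺ m` points to hold it, and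
-- cancellation in `ℕ` applies directly.
sum : Vec (Fin m) (suc k) → Fin (suc k *ᴺ m)
sum xs = fromℕ< (total< xs)

sumEdge : Vec (Fin m) (suc k) → Subset (suc k *ᴺ m + suc k *ᴺ m)
sumEdge xs = transversal xs ++ ⁅ sum xs ⁆

∣sumEdge∣ : (xs : Vec (Fin m) (suc k)) → ∣ sumEdge xs ∣ ≡ suc (suc k)
∣sumEdge∣ {k = k} xs = begin
  ∣ sumEdge xs ∣                       ≡⟨ ∣++∣ (transversal xs) ⁅ sum xs ⁆ ⟩
  ∣ transversal xs ∣ + ∣ ⁅ sum xs ⁆ ∣  ≡⟨ cong₂ _+_ (∣transversal∣ xs) (∣⁅x⁆∣≡1 (sum xs)) ⟩
  suc k + 1                            ≡⟨ ℕ.+-comm (suc k) 1 ⟩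
  suc (suc k)                          ∎
  where open ≡-Reasoning

∣sumEdge∩sumEdge∣ : (xs ys : Vec (Fin m) (suc k)) →
  ∣ sumEdge xs ∩ sumEdge ys ∣ ≡ ∣ ⁅ sum xs ⁆ ∩ ⁅ sum ys ⁆ ∣ + agreement xs ys
∣sumEdge∩sumEdge∣ xs ys =
  trans (∣++∩++∣ (transversal xs) (transversal ys) ⁅ sum xs ⁆ ⁅ sum ys ⁆) (ℕ.+-comm (agreement xs ys) _)

-- If the sums agree, they account for one common point, and at least `k` of the `suc k` coordinates
-- agree. Otherwise all common points come from the coordinates, so all of these agree.
sumEdge-sep : (xs ys : Vec (Fin m) (suc k)) → suc k ≤ᴺ ∣ sumEdge xs ∩ sumEdge ys ∣ → xs ≡ ys
sumEdge-sep xs ys k≤ with k≤′ ← subst (_ ≤ᴺ_) (∣sumEdge∩sumEdge∣ xs ys) k≤ | sum xs Fin.≟ sum ys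
... | yes eq = k≤1+agreement⇒≡ xs ys (Fin.fromℕ<-injective _ _ (total< xs) (total< ys) eq)
  (subst (λ s → _ ≤ᴺ s + agreement xs ys)
    (trans (cong (λ y → ∣ ⁅ sum xs ⁆ ∩ ⁅ y ⁆ ∣) (sym eq)) (∣⁅x⁆∩⁅x⁆∣≡1 (sum xs))) k≤′)
... | no neq = k≤agreement⇒≡ xs ys
  (subst (λ s → _ ≤ᴺ s + agreement xs ys) (∣⁅x⁆∩⁅y⁆∣≡0 neq) k≤′)

-- Enumeration of vectors by base-`m` digits, and arithmetic of the bound.

digits : ∀ k → Fin (m ^ k) → Vec (Fin m) k
digits     zero    i = []
digits {m} (suc k) i = let x , j = remQuot {m} (m ^ k) i in x ∷ digits k j

digits-injective : ∀ k {i j : Fin (m ^ k)} → digits k i ≡ digits k j → i ≡ j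
digits-injective     zero    {Fin.zero} {Fin.zero} _ = refl
digits-injective {m} (suc k) {i} {j} eq with head≡ , tail≡ ← ∷-injective eq = begin
  i                              ≡⟨ Fin.combine-remQuot {m} (m ^ k) i ⟨
  uncurry combine (split i)      ≡⟨ cong₂ combine head≡ (digits-injective k tail≡) ⟩
  uncurry combine (split j)      ≡⟨ Fin.combine-remQuot {m} (m ^ k) j ⟩
  j                              ∎
  where
  open ≡-Reasoning
  split = remQuot {m} (m ^ k)

^-distribʳ-* : ∀ k m n → (m *ᴺ n) ^ k ≡ m ^ k *ᴺ n ^ k
^-distribʳ-* zero    m n = refl
^-distribʳ-* (suc k) m n =
  trans (cong (m *ᴺ n *ᴺ_) (^-distribʳ-* k m n)) (ℕ.[m*n]*[o*p]≡[m*o]*[n*p] m n (m ^ k) (n ^ k))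

-- On unnormalised rationals the order is integer cross-multiplication, which reduces the claim to
-- `m ≤ᴺ d *ᴺ n`.
1/d*m≤n : ∀ d m n .{{_ : NonZero d}} → m ≤ᴺ d *ᴺ n → (+ 1 / d) * (+ m / 1) ≤ + n / 1
1/d*m≤n d@(suc _) m n m≤dn = ℚ.toℚᵘ-cancel-≤ (begin
  ℚ.toℚᵘ ((+ 1 / d) * (+ m / 1))             ≃⟨ ℚ.toℚᵘ-homo-* (+ 1 / d) (+ m / 1) ⟩
  ℚ.toℚᵘ (+ 1 / d) ℚᵘ.* ℚ.toℚᵘ (+ m / 1)     ≃⟨ ℚᵘ.*-cong (ℚ.toℚᵘ-fromℚᵘ (+ 1 ℚᵘ./ d)) (ℚ.toℚᵘ-fromℚᵘ (+ m ℚᵘ./ 1)) ⟩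
  (+ 1 ℚᵘ./ d) ℚᵘ.* (+ m ℚᵘ./ 1)             ≤⟨ ℚᵘ.*≤* le ⟩
  + n ℚᵘ./ 1                                 ≃⟨ ℚ.toℚᵘ-fromℚᵘ (+ n ℚᵘ./ 1) ⟨
  ℚ.toℚᵘ (+ n / 1)                           ∎)
  where
  open ℚᵘ.≤-Reasoning
  le : (+ 1 ℤ.* + m) ℤ.* + 1 ℤ.≤ + n ℤ.* + (d *ᴺ 1)
  le = subst₂ ℤ._≤_
    (sym (trans (ℤ.*-identityʳ (+ 1 ℤ.* + m)) (ℤ.*-identityˡ (+ m))))
    (trans (cong +_ (trans (ℕ.*-comm d n) (cong (n *ᴺ_) (sym (ℕ.*-identityʳ d))))) (ℤ.pos-* n (d *ᴺ 1)))
    (ℤ.+≤+ m≤dn)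

theorem3 : (r : ℕ) → 0 <ᴺ r →
    ∃[ c ] (0ℚ < c ×
    ((N : ℕ) → ∃[ n ] (N ≤ᴺ n ×
    ∃[ H ] (CrossFree {n} r H × Closed r H ×
    ((H' : Hypergraph n) → H' ⊆ᴴ H → cl r H' ≐ (_∈ᴴ H) →
    c * (+ (n ^ r) / 1) ≤ (+ numHyperedges H' / 1))))))
theorem3 r@(suc q) 0<r =
  -- There are `r` blocks of `m` points and a sum block of `r *ᴺ m` points, so `n` is `2rm` and
  -- `n ^ r` is `d` times the number `m ^ r` of edges.
  + 1 / d , ℚ.positive⁻¹ (+ 1 / d) {{ℚ.normalize-pos 1 d}} , λ N →
    -- The summand `N` makes `n` at least `N`; the `3` gives `r *ᴺ m` at least `3r`, which exceeds
    -- `r + 1` because `r` is positive, so `n` exceeds `2r + 2`.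
    let m = 3 + N; edge = λ i → sumEdge {m} {q} (digits r i)
        edge-size = λ i → ∣sumEdge∣ (digits r i)
        edge-sep = λ i j le → digits-injective r (sumEdge-sep (digits r i) (digits r j) le)
        sparse = image-sparse edge edge-size edge-sep
    in
    r *ᴺ m + r *ᴺ m , N≤n N , hull r (image edge) ,
    hull-crossFree sparse , hull-closed sparse , λ H' H'⊆H cl≐H →
      1/d*m≤n d _ _ (begin
        (r *ᴺ m + r *ᴺ m) ^ r       ≡⟨ cong (_^ r) (ℕ.*-distribʳ-+ m r r) ⟨
        ((r + r) *ᴺ m) ^ r          ≡⟨ ^-distribʳ-* r (r + r) m ⟩
        d *ᴺ m ^ r                  ≤⟨ ℕ.*-monoʳ-≤ d (generating-size edge edge-size edge-sep (n-large N) H' H'⊆H (proj₂ cl≐H)) ⟩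
        d *ᴺ numHyperedges H'       ∎)
  where
  open ℕ.≤-Reasoning
  d = (r + r) ^ r
  instance
    d≢0 : NonZero d
    d≢0 = ℕ.m^n≢0 (r + r) r

  N≤n : ∀ N → N ≤ᴺ r *ᴺ (3 + N) + r *ᴺ (3 + N)
  N≤n N = begin
    N                                ≤⟨ ℕ.m≤n+m N 3 ⟩
    3 + N                            ≤⟨ ℕ.m≤n*m (3 + N) r ⟩
    r *ᴺ (3 + N)                     ≤⟨ ℕ.m≤m+n _ _ ⟩
    r *ᴺ (3 + N) + r *ᴺ (3 + N)      ∎

  1+r<rm : ∀ N → suc r <ᴺ r *ᴺ (3 + N)
  1+r<rm N = begin-strict
    1 + r              ≤⟨ ℕ.+-monoˡ-≤ r 0<r ⟩
    r + r              <⟨ ℕ.m<m+n (r + r) 0<r ⟩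
    r + r + r          ≡⟨ trans (ℕ.+-assoc r r r) (cong (λ x → r + (r + x)) (sym (ℕ.+-identityʳ r))) ⟩
    3 *ᴺ r             ≡⟨ ℕ.*-comm 3 r ⟩
    r *ᴺ 3             ≤⟨ ℕ.*-monoʳ-≤ r (ℕ.m≤m+n 3 N) ⟩
    r *ᴺ (3 + N)       ∎

  n-large : ∀ N → suc r + suc r <ᴺ r *ᴺ (3 + N) + r *ᴺ (3 + N)
  n-large N = ℕ.+-mono-< (1+r<rm N) (1+r<rm N)
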